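{- Let $\delta$ be a positive integer. Let $(T_n(x))_{n\ge\delta-1}$ be the polynomials defined by $T_{\delta-1}(x)=1$ and, for $n\ge\delta-1$, $$T_{n+1}(x)=\Bigl(\tfrac{n-\delta+1}{\delta}x^2+x+1+\tfrac{n-\delta+1}{\delta}\Bigr)T_n(x)+\tfrac1\delta\bigl(-x^3+x^2-x+1\bigr)\frac{d}{dx}T_n(x)$$ (so $\deg T_n(x)=n-\delta+1$). Then $T_n(x)$ is unimodal for every $n\ge\delta+2$.
   Context: A polynomial $f(x)=\sum_{k=0}^d f_kx^k$ is unimodal if there is $m$ with $f_0\le f_1\le\cdots\le f_m\ge\cdots\ge f_{d-1}\ge f_d$. -}

module Defs where

open import Data.Nat as ℕ using (ℕ; zero; suc)
open import Data.Integer using (+_)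
open import Data.Rational using (ℚ; 0ℚ; _+_; _*_; _/_; _≤_)
open import Data.List using (List; []; _∷_; map)
open import Data.Product using (_×_; ∃-syntax)
open import Relation.Binary.PropositionalEquality using (_≡_; _≢_)

infix  4 _≈_
infixl 6 _⊕_
infixl 7 _⊗_
infixr 8 _·_

-- Coefficient lists, constant term first. Trailing zeros are allowed, so
-- equality of polynomials is _≈_ and not _≡_.
Poly : Set
Poly = List ℚ

coeff : Poly → ℕ → ℚ
coeff []      _       = 0ℚ
coeff (a ∷ f) zero    = a
coeff (a ∷ f) (suc k) = coeff f k

_≈_ : Poly → Poly → Set
f ≈ g = ∀ k → coeff f k ≡ coeff g k

_⊕_ : Poly → Poly → Poly
[]      ⊕ g       = g
(a ∷ f) ⊕ []      = a ∷ f
(a ∷ f) ⊕ (b ∷ g) = (a + b) ∷ (f ⊕ g)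

_·_ : ℚ → Poly → Poly
c · f = map (c *_) f

-- (a + x f) g = a g + x (f g)
_⊗_ : Poly → Poly → Poly
[]      ⊗ g = []
(a ∷ f) ⊗ g = (a · g) ⊕ (0ℚ ∷ (f ⊗ g))

-- weightFrom k [f₀, f₁, …] = [k f₀, (k+1) f₁, …]
weightFrom : ℕ → Poly → Poly
weightFrom k []      = []
weightFrom k (a ∷ f) = (+ k / 1) * a ∷ weightFrom (suc k) f

derivative : Poly → Poly
derivative []      = []
derivative (_ ∷ f) = weightFrom 1 f

VanishesAbove : Poly → ℕ → Set
VanishesAbove f d = ∀ k → d ℕ.< k → coeff f k ≡ 0ℚ

HasDegree : Poly → ℕ → Set
HasDegree f d = coeff f d ≢ 0ℚ × VanishesAbove f d

-- Some expression f = Σ_{k=0}^d f_k x^k has f_0 ≤ … ≤ f_m ≥ … ≥ f_d with m ≤ d.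
-- Requiring f_d ≠ 0 would only exclude the zero polynomial: dropping vanishing
-- top coefficients preserves the inequalities.
Unimodal : Poly → Set
Unimodal f =
  ∃[ d ] VanishesAbove f d ×
  (∃[ m ] m ℕ.≤ d
    × (∀ k → k ℕ.< m → coeff f k ≤ coeff f (suc k))
    × (∀ k → m ℕ.≤ k → k ℕ.< d → coeff f (suc k) ≤ coeff f k))

{-# OPTIONS --safe #-}

-- Write t(d, k) for δ^d times the coefficient of x^k in T_{δ-1+d}. The recurrence
-- preserves the symmetry t(d, k) = t(d, d - k), so unimodality says that the
-- differences a(d, k) = t(d, k) - t(d, k - 1) are nonnegative for 2k ≤ d + 1.
-- For j = d + 1 - k they satisfy
--   a(d+1, k) = (k+1) a(d, k+1) + (δ+j) a(d, k) + (δ+k-1) a(d, k-1) + (j+2) a(d, k-2),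
-- whose weights are nonnegative. Only a(d, k+1) can lie beyond the middle, where
-- antisymmetry moves it back to the left half; there it is absorbed by another term
-- except when 2k = d + 1, which leaves (δ-2) a(d, k-1) + (k+2) a(d, k-2). For δ = 1
-- this needs control of a(d, k-1) by a(d, k-2), and that is obtained by expanding
-- both terms once more through the recurrence. The induction starts at d = 3.
module Submission where

open import Defs
open import Data.Nat as ℕ using (ℕ; zero; suc; NonZero; z≤n; s≤s; ⌊_/2⌋; ⌈_/2⌉)
import Data.Nat.Properties as ℕ
open import Data.Integer as ℤ using (ℤ; +_; -[1+_]; +[1+_]; +0; 0ℤ; 1ℤ)
import Data.Integer.Properties as ℤ
import Data.Integer.Tactic.RingSolver as ℤ
import Data.Rational.Unnormalised as ℚᵘ
import Data.Rational.Unnormalised.Properties as ℚᵘ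
open import Data.List using ([]; _∷_)
open import Data.Product using (_×_; _,_; proj₁; ∃-syntax)
open import Level using (0ℓ)
open import Relation.Binary.PropositionalEquality
open import Relation.Nullary using (yes; no)
open import Relation.Nullary.Decidable using (dec⇒maybe)
open import Tactic.RingSolver.Core.AlmostCommutativeRing using (AlmostCommutativeRing; fromCommutativeRing)

-- Sign rules and index arithmetic in the integers.

module IntegerRecurrence where

  open import Data.Integer using (_+_; _-_; _*_; -_; _≤_; _<_; +≤+; +<+)
  open import Data.Integer.Properties
  open import Data.Integer.Tactic.RingSolver using (solve-∀)

  0≤+_ : ∀ n → 0ℤ ≤ + n
  0≤+ n = +≤+ z≤n

  0≤x+y : ∀ {x y} → 0ℤ ≤ x → 0ℤ ≤ y → 0ℤ ≤ x + y
  0≤x+y = +-mono-≤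

  0≤x*y : ∀ {x y} → 0ℤ ≤ x → 0ℤ ≤ y → 0ℤ ≤ x * y
  0≤x*y {+ m} {+ n} _ _ = subst (0ℤ ≤_) (pos-* m n) (0≤+ (m ℕ.* n))

  0<x*y : ∀ {x y} → 0ℤ < x → 0ℤ < y → 0ℤ < x * y
  0<x*y {+[1+ m ]} {+[1+ n ]} _ _ = +<+ (s≤s z≤n)
  0<x*y {+0} (+<+ ())
  0<x*y {_} {+0} _ (+<+ ())

  0≤-combination : ∀ {p q r u x y z w} → 0ℤ ≤ p → 0ℤ ≤ q → 0ℤ ≤ r → 0ℤ ≤ u →
    0ℤ ≤ x → 0ℤ ≤ y → 0ℤ ≤ z → 0ℤ ≤ w → 0ℤ ≤ p * x + q * y + r * z + u * w
  0≤-combination p q r u x y z w =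
    0≤x+y (0≤x+y (0≤x+y (0≤x*y p x) (0≤x*y q y)) (0≤x*y r z)) (0≤x*y u w)

  x≡-x⇒x≡0 : ∀ {x} → x ≡ - x → x ≡ 0ℤ
  x≡-x⇒x≡0 {+0} _ = refl

  k-1+1≡k : ∀ k → k - 1ℤ + 1ℤ ≡ k
  k-1+1≡k = solve-∀

  k+1-1≡k : ∀ k → k + 1ℤ - 1ℤ ≡ k
  k+1-1≡k = solve-∀

  k-1+[j+1]≡k+j : ∀ k j → k - 1ℤ + (j + 1ℤ) ≡ k + j
  k-1+[j+1]≡k+j = solve-∀

  ≡suc⇒≡ : ∀ {d x y} → x ≡ + suc d → y + 1ℤ ≡ x → y ≡ + d
  ≡suc⇒≡ {d} {_} {y} x≡1+d y+1≡x =
    trans (e₁ y) (trans (cong (_- 1ℤ) (trans y+1≡x x≡1+d)) (e₂ (+ d)))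
    where
    e₁ : ∀ y → y ≡ y + 1ℤ - 1ℤ
    e₁ = solve-∀
    e₂ : ∀ d → + 1 + d - 1ℤ ≡ d
    e₂ = solve-∀

  -- The integer triangle of scaled coefficients: symmetry, support, positivity.

  module Coefficients (s : ℕ) where

    -- t d k is δ^d times the coefficient of x^k in T_{δ-1+d}, where δ = s + 1. The
    -- recurrence holds for every integer k: its weights vanish where it would leave
    -- the range 0 ≤ k ≤ d.
    t : ℕ → ℤ → ℤ
    t zero    +0       = + 1
    t zero    +[1+ _ ] = + 0
    t zero    -[1+ _ ] = + 0
    t (suc d) k        =
      (+ suc s + + d - k) * t d k + (+ s + k) * t d (k - 1ℤ)
      + (+ d - k + + 2) * t d (k - 1ℤ - 1ℤ) + (k + 1ℤ) * t d (k + 1ℤ)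

    -- With the complementary index j = d + 1 - k, the weights become visibly nonnegative for 0 ≤ k
    -- ≤ d + 1, and exchanging k and j swaps them in pairs.
    t-step : ∀ d k j → k + j ≡ + suc d → t (suc d) k ≡
      (+ s + j) * t d k + (+ s + k) * t d (k - 1ℤ)
      + (j + 1ℤ) * t d (k - 1ℤ - 1ℤ) + (k + 1ℤ) * t d (k + 1ℤ)
    t-step d k j k+j≡1+d = cong₂ (λ u v →
        u * t d k + (+ s + k) * t d (k - 1ℤ) + v * t d (k - 1ℤ - 1ℤ) + (k + 1ℤ) * t d (k + 1ℤ))
        (trans (e₁ (+ s) (+ d) k) (trans (cong (λ x → + s + x - k) (sym k+j≡1+d)) (e₂ (+ s) j k)))
        (trans (e₃ (+ d) k) (trans (cong (λ x → x - k + 1ℤ) (sym k+j≡1+d)) (e₄ j k)))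
      where
      e₁ : ∀ s d k → (+ 1 + s) + d - k ≡ s + (+ 1 + d) - k
      e₁ = solve-∀
      e₂ : ∀ s j k → s + (k + j) - k ≡ s + j
      e₂ = solve-∀
      e₃ : ∀ d k → d - k + + 2 ≡ (+ 1 + d) - k + 1ℤ
      e₃ = solve-∀
      e₄ : ∀ j k → (k + j) - k + 1ℤ ≡ j + 1ℤ
      e₄ = solve-∀

    t-negative : ∀ d n → t d -[1+ n ] ≡ 0ℤ
    t-negative zero    n = refl
    -- At k = -1 the only entry that need not vanish is `t d 0`, and its weight k + 1 is zero.
    t-negative (suc d) zero
      rewrite t-negative d 0 | t-negative d 1 | t-negative d 2 = lemma (+ s) (+ d)
      where
      lemma : ∀ s d → (+ 1 + s + d - - + 1) * + 0 + (s + - + 1) * + 0 + (d - - + 1 + + 2) * + 0 + + 0 ≡ + 0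
      lemma = solve-∀
    t-negative (suc d) (suc n)
      rewrite t-negative d (suc n) | t-negative d (suc (suc n ℕ.+ 0))
            | t-negative d (suc (suc (suc n ℕ.+ 0) ℕ.+ 0)) | t-negative d n
      = lemma (+ suc s + + d - -[1+ suc n ]) (+ s + -[1+ suc n ]) (+ d - -[1+ suc n ] + + 2) -[1+ n ]
      where
      lemma : ∀ x y z w → x * + 0 + y * + 0 + z * + 0 + w * + 0 ≡ + 0
      lemma = solve-∀

    -- By induction, reflecting the four entries of row d turns the expansion at i into the one at
    -- j, with the first two terms swapped and the last two swapped. Indices outside the range are
    -- included, so no boundary cases arise in the step.
    t-symmetric : ∀ d {i j} → i + j ≡ + d → t d i ≡ t d j
    t-symmetric zero {+0}       {+0}           _ = refl
    t-symmetric zero {+[1+ _ ]} { -[1+ _ ]}    _ = refl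
    t-symmetric zero { -[1+ _ ]} {+[1+ _ ]}    _ = refl
    t-symmetric (suc d) {i} {j} e = begin
      t (suc d) i
        ≡⟨ t-step d i j e ⟩
      (+ s + j) * t d i + (+ s + i) * t d (i - 1ℤ)
      + (j + 1ℤ) * t d (i - 1ℤ - 1ℤ) + (i + 1ℤ) * t d (i + 1ℤ)
        ≡⟨ cong₂ _+_ (cong₂ _+_ (cong₂ _+_
             (cong ((+ s + j) *_) (t-symmetric d (≡suc⇒≡ e (e₁ i j))))
             (cong ((+ s + i) *_) (t-symmetric d (≡suc⇒≡ e (e₂ i j)))))
             (cong ((j + 1ℤ) *_) (t-symmetric d (≡suc⇒≡ e (e₃ i j)))))
             (cong ((i + 1ℤ) *_) (t-symmetric d (≡suc⇒≡ e (e₄ i j)))) ⟩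
      (+ s + j) * t d (j - 1ℤ) + (+ s + i) * t d j
      + (j + 1ℤ) * t d (j + 1ℤ) + (i + 1ℤ) * t d (j - 1ℤ - 1ℤ)
        ≡⟨ swap ((+ s + j) * t d (j - 1ℤ)) ((+ s + i) * t d j) ((j + 1ℤ) * t d (j + 1ℤ)) _ ⟩
      (+ s + i) * t d j + (+ s + j) * t d (j - 1ℤ)
      + (i + 1ℤ) * t d (j - 1ℤ - 1ℤ) + (j + 1ℤ) * t d (j + 1ℤ)
        ≡⟨ t-step d j i (trans (+-comm j i) e) ⟨
      t (suc d) j ∎
      where
      open ≡-Reasoning
      e₁ : ∀ i j → i + (j - 1ℤ) + 1ℤ ≡ i + j
      e₁ = solve-∀
      e₂ : ∀ i j → i - 1ℤ + j + 1ℤ ≡ i + j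
      e₂ = solve-∀
      e₃ : ∀ i j → i - 1ℤ - 1ℤ + (j + 1ℤ) + 1ℤ ≡ i + j
      e₃ = solve-∀
      e₄ : ∀ i j → i + 1ℤ + (j - 1ℤ - 1ℤ) + 1ℤ ≡ i + j
      e₄ = solve-∀
      swap : ∀ x y z w → x + y + z + w ≡ y + x + w + z
      swap = solve-∀

    t-above : ∀ d n → t d (+ d + + suc n) ≡ 0ℤ
    t-above d n = trans (t-symmetric d (lemma (+ d) (+ suc n))) (t-negative d n)
      where
      lemma : ∀ x y → x + y + - y ≡ x
      lemma = solve-∀

    -- Inside the range every weight of `t-step` is nonnegative. Outside it weights may be negative,
    -- but there the entry is zero.
    0≤t : ∀ d k → 0ℤ ≤ t d k
    0≤t d -[1+ n ] = ≤-reflexive (sym (t-negative d n))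
    0≤t zero +0 = 0≤+ 1
    0≤t zero +[1+ n ] = ≤-refl
    0≤t (suc d) (+ k) with k ℕ.≤? suc d
    ... | yes k≤1+d with ℕ.m≤n⇒∃[o]m+o≡n k≤1+d
    ...   | j , k+j≡1+d = subst (0ℤ ≤_)
            (sym (t-step d (+ k) (+ j) (cong +_ k+j≡1+d)))
            (0≤-combination {+ (s ℕ.+ j)} {+ (s ℕ.+ k)} {+ (j ℕ.+ 1)} {+ (k ℕ.+ 1)}
              (0≤+ _) (0≤+ _) (0≤+ _) (0≤+ _)
              (0≤t d _) (0≤t d _) (0≤t d _) (0≤t d _))
    0≤t (suc d) (+ k) | no k≰1+d with ℕ.m≤n⇒∃[o]m+o≡n (ℕ.≰⇒> k≰1+d)
    ...   | j , 2+d+j≡k = ≤-reflexive (sym (trans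
            (cong (λ i → t (suc d) (+ i)) (trans (sym 2+d+j≡k) (sym (ℕ.+-suc (suc d) j))))
            (t-above (suc d) j)))

    -- The weight of `t d 0` is s + d + 1 > 0, and the other terms are nonnegative. By symmetry this
    -- also makes the top coefficient nonzero, which fixes the degree.
    0<t-bottom : ∀ d → 0ℤ < t d 0ℤ
    0<t-bottom zero = +<+ (s≤s z≤n)
    0<t-bottom (suc d) = subst (0ℤ <_) (sym (t-step d 0ℤ (+ suc d) refl))
      (+-mono-<-≤ (+-mono-<-≤ (+-mono-<-≤
        (0<x*y {+ (s ℕ.+ suc d)} (+<+ (ℕ.≤-trans (s≤s z≤n) (ℕ.m≤n+m (suc d) s))) (0<t-bottom d))
        (0≤x*y {+ (s ℕ.+ 0)} (0≤+ _) (0≤t d _)))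
        (0≤x*y {+ (suc d ℕ.+ 1)} (0≤+ _) (0≤t d _)))
        (0≤x*y (0≤+ 1) (0≤t d _)))

    0<t-top : ∀ d → 0ℤ < t d (+ d)
    0<t-top d = subst (0ℤ <_) (t-symmetric d refl) (0<t-bottom d)

    -- Consecutive differences and their recurrence.

    a : ℕ → ℤ → ℤ
    a d k = t d k - t d (k - 1ℤ)

    a-negative : ∀ d n → a d -[1+ n ] ≡ 0ℤ
    a-negative d n rewrite t-negative d n | t-negative d (suc (n ℕ.+ 0)) = refl

    a-antisymmetric : ∀ d {i j} → i + j ≡ + suc d → a d i ≡ - a d j
    a-antisymmetric d {i} {j} e = trans
      (cong₂ _-_ (t-symmetric d (≡suc⇒≡ e (e₁ i j))) (t-symmetric d (≡suc⇒≡ e (e₂ i j))))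
      (e₃ (t d (j - 1ℤ)) (t d j))
      where
      e₁ : ∀ i j → i + (j - 1ℤ) + 1ℤ ≡ i + j
      e₁ = solve-∀
      e₂ : ∀ i j → i - 1ℤ + j + 1ℤ ≡ i + j
      e₂ = solve-∀
      e₃ : ∀ x y → x - y ≡ - (y - x)
      e₃ = solve-∀

    a-middle : ∀ d {k} → k + k ≡ + suc d → a d k ≡ 0ℤ
    a-middle d e = x≡-x⇒x≡0 (a-antisymmetric d e)

    -- The four weights of `t-step` have a sum depending only on k + j. Subtracting the expansion at
    -- k - 1 therefore leaves coefficients of total zero, and these telescope into differences.
    a-step : ∀ d k j → k + j ≡ + suc d → a (suc d) k ≡
      (k + 1ℤ) * a d (k + 1ℤ) + (+ s + 1ℤ + j) * a d k
      + (+ s + k) * a d (k - 1ℤ) + (j + + 2) * a d (k - 1ℤ - 1ℤ)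
    a-step d k j e
      rewrite t-step d k j e
            | t-step d (k - 1ℤ) (j + 1ℤ) (trans (k-1+[j+1]≡k+j k j) e)
            | k-1+1≡k k | k+1-1≡k k
      = regroup (+ s) j k (t d (k + 1ℤ)) (t d k) (t d (k - 1ℤ)) (t d (k - 1ℤ - 1ℤ)) (t d (k - 1ℤ - 1ℤ - 1ℤ))
      where
      regroup : ∀ s j k u x y z w →
        ((s + j) * x + (s + k) * y + (j + 1ℤ) * z + (k + 1ℤ) * u)
        - ((s + (j + 1ℤ)) * y + (s + (k - 1ℤ)) * z + (j + 1ℤ + 1ℤ) * w + k * x)
        ≡ (k + 1ℤ) * (u - x) + (s + 1ℤ + j) * (x - y) + (s + k) * (y - z) + (j + + 2) * (z - w)
      regroup = solve-∀

    -- The natural number r = d + 1 - 2k is the slack in 2k ≤ d + 1. The induction step splits on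
    -- it.
    IncreasingToMiddle : ℕ → Set
    IncreasingToMiddle d = ∀ k r → k + k + + r ≡ + suc d → 0ℤ ≤ a d k

    -- The right-hand side equals a (suc d) k. The condition says that, for odd d, the new
    -- difference just left of the centre keeps the right sign; given
    -- IncreasingToMiddle d, it is automatic unless δ = 1.
    CentralBound : ℕ → Set
    CentralBound d = ∀ k → k + k ≡ + suc d →
      0ℤ ≤ (+ s - 1ℤ) * a d (k - 1ℤ) + (k + + 2) * a d (k - 1ℤ - 1ℤ)

    -- The induction step.

    module _ {d} (increasing : IncreasingToMiddle d) where

      0≤a-1 : ∀ k r → k + k + + r ≡ + suc d → 0ℤ ≤ a d (k - 1ℤ)
      0≤a-1 k r e = increasing (k - 1ℤ) (suc (suc r)) (trans (lemma k (+ r)) e)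
        where
        lemma : ∀ k r → k - 1ℤ + (k - 1ℤ) + (+ 2 + r) ≡ k + k + r
        lemma = solve-∀

      0≤a-2 : ∀ k r → k + k + + r ≡ + suc d → 0ℤ ≤ a d (k - 1ℤ - 1ℤ)
      0≤a-2 k r e = increasing (k - 1ℤ - 1ℤ) (suc (suc (suc (suc r)))) (trans (lemma k (+ r)) e)
        where
        lemma : ∀ k r → k - 1ℤ - 1ℤ + (k - 1ℤ - 1ℤ) + (+ 4 + r) ≡ k + k + r
        lemma = solve-∀

      increasing-suc : CentralBound d → IncreasingToMiddle (suc d)
      increasing-suc bound -[1+ n ] _ _ = ≤-reflexive (sym (a-negative (suc d) n))
      increasing-suc bound (+ i) zero e =
        ≤-reflexive (sym (a-middle (suc d) {+ i} (trans (sym (+-identityʳ (+ i + + i))) e)))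
      -- Here 2k = d + 1: in row d the index k is central, so its difference is zero, and k + 1
      -- reflects to k - 1. What remains is the expression in `CentralBound`.
      increasing-suc bound (+ i) (suc zero) e =
        subst (0ℤ ≤_) (sym a≡) (bound k k+k≡1+d)
        where
        k = + i
        k+k≡1+d : k + k ≡ + suc d
        k+k≡1+d = ≡suc⇒≡ e refl
        regroup : ∀ s k y z → (k + 1ℤ) * - y + (s + 1ℤ + k) * + 0 + (s + k) * y + (k + + 2) * z
                            ≡ (s - 1ℤ) * y + (k + + 2) * z
        regroup = solve-∀
        a≡ : a (suc d) k ≡ (+ s - 1ℤ) * a d (k - 1ℤ) + (k + + 2) * a d (k - 1ℤ - 1ℤ)
        a≡ = trans (a-step d k k k+k≡1+d) (trans
          (cong₂ (λ x y → (k + 1ℤ) * x + (+ s + 1ℤ + k) * y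
                          + (+ s + k) * a d (k - 1ℤ) + (k + + 2) * a d (k - 1ℤ - 1ℤ))
            (a-antisymmetric d (trans (lemma k) k+k≡1+d)) (a-middle d k+k≡1+d))
          (regroup (+ s) k _ _))
          where
          lemma : ∀ k → k + 1ℤ + (k - 1ℤ) ≡ k + k
          lemma = solve-∀
      -- Here 2k = d and j = k + 1, so k + 1 reflects to k. The negative weight k + 1 is absorbed by
      -- s + 1 + j, leaving s + 1; the product of zeros only fills the vacated slot of
      -- `0≤-combination`.
      increasing-suc bound (+ i) (suc (suc zero)) e =
        subst (0ℤ ≤_) (sym a≡) (0≤-combination (0≤+ 0) (0≤+ (s ℕ.+ 1)) (0≤+ (s ℕ.+ i)) (0≤+ (i ℕ.+ 3))
          (0≤+ 0) (increasing k 1 k+k+1≡1+d) (0≤a-1 k 1 k+k+1≡1+d) (0≤a-2 k 1 k+k+1≡1+d))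
        where
        k = + i
        k+k+1≡1+d : k + k + 1ℤ ≡ + suc d
        k+k+1≡1+d = ≡suc⇒≡ e (+-assoc (k + k) 1ℤ 1ℤ)
        regroup : ∀ s k x y z →
          (k + 1ℤ) * - x + (s + 1ℤ + (k + 1ℤ)) * x + (s + k) * y + (k + 1ℤ + + 2) * z
          ≡ + 0 * + 0 + (s + 1ℤ) * x + (s + k) * y + (k + + 3) * z
        regroup = solve-∀
        a≡ : a (suc d) k ≡ + 0 * + 0 + (+ s + 1ℤ) * a d k
             + (+ s + k) * a d (k - 1ℤ) + (k + + 3) * a d (k - 1ℤ - 1ℤ)
        a≡ = trans (a-step d k (k + 1ℤ) (trans (sym (+-assoc k k 1ℤ)) k+k+1≡1+d)) (trans
          (cong (λ x → (k + 1ℤ) * x + (+ s + 1ℤ + (k + 1ℤ)) * a d k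
                       + (+ s + k) * a d (k - 1ℤ) + (k + 1ℤ + + 2) * a d (k - 1ℤ - 1ℤ))
            (a-antisymmetric d (trans (lemma k) k+k+1≡1+d)))
          (regroup (+ s) k _ _ _))
          where
          lemma : ∀ k → k + 1ℤ + k ≡ k + k + 1ℤ
          lemma = solve-∀
      increasing-suc bound (+ i) (suc (suc (suc r))) e =
        subst (0ℤ ≤_) (sym (a-step d k j (trans (e₁ k (+ r)) k+k+2+r≡1+d)))
          (0≤-combination (0≤+ (i ℕ.+ 1)) (0≤+ (s ℕ.+ 1 ℕ.+ (i ℕ.+ suc (suc r))))
            (0≤+ (s ℕ.+ i)) (0≤+ (i ℕ.+ suc (suc r) ℕ.+ 2))
            (increasing (k + 1ℤ) r (trans (e₂ k (+ r)) k+k+2+r≡1+d))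
            (increasing k _ k+k+2+r≡1+d) (0≤a-1 k _ k+k+2+r≡1+d) (0≤a-2 k _ k+k+2+r≡1+d))
        where
        k = + i
        j = k + + suc (suc r)
        k+k+2+r≡1+d : k + k + + suc (suc r) ≡ + suc d
        k+k+2+r≡1+d = ≡suc⇒≡ e (e₃ k (+ r))
          where
          e₃ : ∀ k r → k + k + (+ 2 + r) + 1ℤ ≡ k + k + (+ 3 + r)
          e₃ = solve-∀
        e₁ : ∀ k r → k + (k + (+ 2 + r)) ≡ k + k + (+ 2 + r)
        e₁ = solve-∀
        e₂ : ∀ k r → k + 1ℤ + (k + 1ℤ) + r ≡ k + k + (+ 2 + r)
        e₂ = solve-∀

      -- Both differences are expanded in row d, where the index k reflects to k - 1. For s = 0 the
      -- factor s - 1 makes the first expansion nonpositive, but the second, multiplied by k + 2,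
      -- outweighs it term by term.
      centralBound-suc : 3 ℕ.≤ d → CentralBound (suc d)
      centralBound-suc 3≤d k e with k≥3 k (ℕ.+-monoʳ-≤ 2 3≤d) e
        where
        k≥3 : ∀ k {m} → 5 ℕ.≤ m → k + k ≡ + m → ∃[ n ] k ≡ + (3 ℕ.+ n)
        k≥3 (+ suc (suc (suc n))) _ _ = n , refl
        k≥3 (+ 0) (s≤s _) ()
        k≥3 (+ 1) (s≤s (s≤s (s≤s _))) ()
        k≥3 (+ 2) (s≤s (s≤s (s≤s (s≤s (s≤s _))))) ()
      -- The collected weight of `b₃` is (k + 2)(2s + k - 3), which is where k ≥ 3 matters; this
      -- follows from 2k = d + 2 ≥ 5. Substituting k = n + 3 makes all four weights polynomials with
      -- nonnegative coefficients.
      ... | n , refl = subst (0ℤ ≤_) (sym bound≡)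
        (0≤-combination
          (0≤x+y (0≤x+y (0≤x*y (0≤+ s) (0≤+ s)) (0≤x*y (0≤+ n) (0≤+ n))) (0≤x+y (0≤x*y (0≤+ 7) (0≤+ n)) (0≤+ 9)))
          (0≤x+y (0≤x+y (0≤x*y (0≤+ s) (0≤+ _)) (0≤x*y (0≤+ n) (0≤+ (n ℕ.+ 9)))) (0≤+ 23))
          (0≤x*y (0≤+ (n ℕ.+ 5)) (0≤+ (s ℕ.+ s ℕ.+ n)))
          (0≤x*y (0≤+ (n ℕ.+ 5)) (0≤+ (n ℕ.+ 6)))
          -- Since d + 1 = 2k - 1, the index k - i has slack 2i - 1.
          (increasing (k - 1ℤ) 1 (trans (e₁ k) k+[k-1]≡1+d))
          (increasing (k - 1ℤ - 1ℤ) 3 (trans (e₂ k) k+[k-1]≡1+d))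
          (increasing (k - 1ℤ - 1ℤ - 1ℤ) 5 (trans (e₃ k) k+[k-1]≡1+d))
          (increasing (k - 1ℤ - 1ℤ - 1ℤ - 1ℤ) 7 (trans (e₄ k) k+[k-1]≡1+d)))
        where
        k+[k-1]≡1+d : k + (k - 1ℤ) ≡ + suc d
        k+[k-1]≡1+d = ≡suc⇒≡ e (lemma k)
          where
          lemma : ∀ k → k + (k - 1ℤ) + 1ℤ ≡ k + k
          lemma = solve-∀
        e₁ : ∀ k → k - 1ℤ + (k - 1ℤ) + 1ℤ ≡ k + (k - 1ℤ)
        e₁ = solve-∀
        e₂ : ∀ k → k - 1ℤ - 1ℤ + (k - 1ℤ - 1ℤ) + + 3 ≡ k + (k - 1ℤ)
        e₂ = solve-∀
        e₃ : ∀ k → k - 1ℤ - 1ℤ - 1ℤ + (k - 1ℤ - 1ℤ - 1ℤ) + + 5 ≡ k + (k - 1ℤ)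
        e₃ = solve-∀
        e₄ : ∀ k → k - 1ℤ - 1ℤ - 1ℤ - 1ℤ + (k - 1ℤ - 1ℤ - 1ℤ - 1ℤ) + + 7 ≡ k + (k - 1ℤ)
        e₄ = solve-∀
        b₁ = a d (k - 1ℤ)
        b₂ = a d (k - 1ℤ - 1ℤ)
        b₃ = a d (k - 1ℤ - 1ℤ - 1ℤ)
        b₄ = a d (k - 1ℤ - 1ℤ - 1ℤ - 1ℤ)
        a-1≡ : a (suc d) (k - 1ℤ) ≡ (k - 1ℤ + 1ℤ) * - b₁ + (+ s + 1ℤ + k) * b₁
               + (+ s + (k - 1ℤ)) * b₂ + (k + + 2) * b₃
        a-1≡ = trans (a-step d (k - 1ℤ) k (trans (+-comm (k - 1ℤ) k) k+[k-1]≡1+d))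
          (cong (λ x → (k - 1ℤ + 1ℤ) * x + (+ s + 1ℤ + k) * b₁ + (+ s + (k - 1ℤ)) * b₂ + (k + + 2) * b₃)
            (trans (cong (a d) (k-1+1≡k k)) (a-antisymmetric d k+[k-1]≡1+d)))
        a-2≡ : a (suc d) (k - 1ℤ - 1ℤ) ≡ (k - 1ℤ - 1ℤ + 1ℤ) * b₁ + (+ s + 1ℤ + (k + 1ℤ)) * b₂
               + (+ s + (k - 1ℤ - 1ℤ)) * b₃ + (k + 1ℤ + + 2) * b₄
        a-2≡ = trans (a-step d (k - 1ℤ - 1ℤ) (k + 1ℤ) (trans (lemma k) k+[k-1]≡1+d))
          (cong (λ i → (k - 1ℤ - 1ℤ + 1ℤ) * a d i + (+ s + 1ℤ + (k + 1ℤ)) * b₂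
                       + (+ s + (k - 1ℤ - 1ℤ)) * b₃ + (k + 1ℤ + + 2) * b₄)
            (k-1+1≡k (k - 1ℤ)))
          where
          lemma : ∀ k → k - 1ℤ - 1ℤ + (k + 1ℤ) ≡ k + (k - 1ℤ)
          lemma = solve-∀
        bound≡ : _ ≡ _
        bound≡ = trans (cong₂ (λ x y → (+ s - 1ℤ) * x + (k + + 2) * y) a-1≡ a-2≡)
          (regroup (+ s) (+ n) b₁ b₂ b₃ b₄)
          where
          regroup : ∀ s n x y z w → let k = + 3 + n in
            (s - 1ℤ) * ((k - 1ℤ + 1ℤ) * - x + (s + 1ℤ + k) * x + (s + (k - 1ℤ)) * y + (k + + 2) * z)
            + (k + + 2) * ((k - 1ℤ - 1ℤ + 1ℤ) * x + (s + 1ℤ + (k + 1ℤ)) * y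
                          + (s + (k - 1ℤ - 1ℤ)) * z + (k + 1ℤ + + 2) * w)
            ≡ (s * s + n * n + (+ 7 * n + + 9)) * x + (s * (s + n + n + + 6) + n * (n + + 9) + + 23) * y
              + (n + + 5) * (s + s + n) * z + (n + + 5) * (n + + 6) * w
          regroup = solve-∀

    -- The base case d = 3 and the resulting induction.

    t₁₀≡ : t 1 0ℤ ≡ + suc s
    t₁₀≡ = trans (t-step 0 0ℤ (+ 1) refl) (lemma (+ s))
      where
      lemma : ∀ s → (s + + 1) * + 1 + (s + + 0) * + 0 + + 0 + + 0 ≡ + 1 + s
      lemma = solve-∀

    t₂₀≡ : t 2 0ℤ ≡ (+ s + + 3) * + suc s
    t₂₀≡ = trans (t-step 1 0ℤ (+ 2) refl) (trans
      (cong₂ (λ x y → (+ s + + 2) * x + (+ s + + 0) * t 1 -[1+ 0 ] + + 3 * t 1 -[1+ 1 ] + + 1 * y)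
        t₁₀≡ (trans (t-symmetric 1 {+ 1} {+ 0} refl) t₁₀≡))
      (trans (cong₂ (λ x y → (+ s + + 2) * + suc s + (+ s + + 0) * x + + 3 * y + + 1 * + suc s)
        (t-negative 1 0) (t-negative 1 1)) (lemma (+ s))))
      where
      lemma : ∀ s → (s + + 2) * (+ 1 + s) + (s + + 0) * + 0 + + 0 + + 1 * (+ 1 + s) ≡ (s + + 3) * (+ 1 + s)
      lemma = solve-∀

    t₂₁≡ : t 2 (+ 1) ≡ + 2 * (+ suc s * + suc s)
    t₂₁≡ = trans (t-step 1 (+ 1) (+ 1) refl) (trans
      (cong₂ (λ x y → (+ s + + 1) * x + (+ s + + 1) * y + + 2 * t 1 -[1+ 0 ] + + 2 * t 1 (+ 2))
        (trans (t-symmetric 1 {+ 1} {+ 0} refl) t₁₀≡) t₁₀≡)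
      (trans (cong₂ (λ x y → (+ s + + 1) * + suc s + (+ s + + 1) * + suc s + + 2 * x + + 2 * y)
        (t-negative 1 0) (t-above 1 0)) (lemma (+ s))))
      where
      lemma : ∀ s → (s + + 1) * (+ 1 + s) + (s + + 1) * (+ 1 + s) + + 0 + + 0 ≡ + 2 * ((+ 1 + s) * (+ 1 + s))
      lemma = solve-∀

    a₃₁≡ : a 3 (+ 1) ≡ + 2 * (+ suc s * (+ suc s * + suc s))
    a₃₁≡ = trans (a-step 2 (+ 1) (+ 2) refl) (trans
      (cong₂ (λ x y → (+ 2) * x + (+ s + + 1 + + 2) * a 2 (+ 1) + (+ s + + 1) * a 2 (+ 0) + + 4 * y)
        (a-antisymmetric 2 {+ 2} {+ 1} refl) (a-negative 2 0))
      (trans (cong₂ (λ x y → + 2 * - (x - y) + (+ s + + 1 + + 2) * (x - y)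
                              + (+ s + + 1) * (y - t 2 -[1+ 0 ]) + + 4 * + 0) t₂₁≡ t₂₀≡)
      (trans (cong (λ x → + 2 * - (+ 2 * (+ suc s * + suc s) - (+ s + + 3) * + suc s)
                          + (+ s + + 1 + + 2) * (+ 2 * (+ suc s * + suc s) - (+ s + + 3) * + suc s)
                          + (+ s + + 1) * ((+ s + + 3) * + suc s - x) + + 4 * + 0) (t-negative 2 0))
        (lemma (+ s)))))
      where
      lemma : ∀ s → let D = + 1 + s in
        + 2 * - (+ 2 * (D * D) - (s + + 3) * D) + (s + + 1 + + 2) * (+ 2 * (D * D) - (s + + 3) * D)
        + (s + + 1) * ((s + + 3) * D - + 0) + + 4 * + 0 ≡ + 2 * (D * (D * D))
      lemma = solve-∀

    a₃₀≡ : a 3 0ℤ ≡ (+ s + + 3) * ((+ s + + 3) * + suc s) + + 2 * (+ suc s * + suc s)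
    a₃₀≡ = trans (cong₂ _-_ (t-step 2 0ℤ (+ 3) refl) (t-negative 3 0)) (trans
      (cong₂ (λ x y → (+ s + + 3) * x + (+ s + + 0) * t 2 -[1+ 0 ] + + 4 * t 2 -[1+ 1 ] + + 1 * y - + 0)
        t₂₀≡ t₂₁≡)
      (trans (cong₂ (λ x y → (+ s + + 3) * ((+ s + + 3) * + suc s) + (+ s + + 0) * x + + 4 * y
                              + + 1 * (+ 2 * (+ suc s * + suc s)) - + 0)
        (t-negative 2 0) (t-negative 2 1)) (lemma (+ s) (+ suc s))))
      where
      lemma : ∀ s D →
        (s + + 3) * ((s + + 3) * D) + (s + + 0) * + 0 + + 0 + + 1 * (+ 2 * (D * D)) - + 0
        ≡ (s + + 3) * ((s + + 3) * D) + + 2 * (D * D)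
      lemma = solve-∀

    -- Row 2 is δ(δ+2), 2δ², δ(δ+2), which for δ = 1 reads 3, 2, 3 and is not unimodal; hence the
    -- start at row 3. There the left half consists of k = 0 and k = 1, with the centre at k = 2.
    increasing₃ : IncreasingToMiddle 3
    increasing₃ -[1+ n ] _ _ = ≤-reflexive (sym (a-negative 3 n))
    increasing₃ (+ 0) _ _ = subst (0ℤ ≤_) (sym a₃₀≡)
      (0≤x+y (0≤x*y {+ (s ℕ.+ 3)} (0≤+ _) (0≤x*y {+ (s ℕ.+ 3)} (0≤+ _) (0≤+ suc s)))
             (0≤x*y (0≤+ 2) (0≤x*y (0≤+ suc s) (0≤+ suc s))))
    increasing₃ (+ 1) _ _ = subst (0ℤ ≤_) (sym a₃₁≡)
      (0≤x*y (0≤+ 2) (0≤x*y (0≤+ suc s) (0≤x*y (0≤+ suc s) (0≤+ suc s))))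
    increasing₃ (+ 2) _ _ = ≤-reflexive (sym (a-middle 3 {+ 2} refl))
    increasing₃ (+ suc (suc (suc k))) r e
      rewrite ℕ.+-suc k (suc (suc k)) | ℕ.+-suc k (suc k) with () ← e

    -- Only k = 2 satisfies the equation. For δ = 1 the first term is -2, against 44 from the
    -- second.
    centralBound₃ : CentralBound 3
    centralBound₃ (+ 2) _ = subst (0ℤ ≤_)
      (sym (trans (cong₂ (λ x y → (+ s - 1ℤ) * x + + 4 * y) a₃₁≡ a₃₀≡) (lemma (+ s))))
      (0≤x*y (0≤+ suc s) (0≤x+y (0≤x*y (0≤+ s)
        (0≤x+y (0≤x*y (0≤+ s) (0≤+ (s ℕ.+ s ℕ.+ 6))) (0≤+ 30))) (0≤+ 42)))
      where
      lemma : ∀ s → let D = + 1 + s in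
        (s - 1ℤ) * (+ 2 * (D * (D * D))) + + 4 * ((s + + 3) * ((s + + 3) * D) + + 2 * (D * D))
        ≡ D * (s * (s * (s + s + + 6) + + 30) + + 42)
      lemma = solve-∀
    centralBound₃ (+ suc (suc (suc k))) e
      rewrite ℕ.+-suc k (suc (suc k)) | ℕ.+-suc k (suc k) with () ← e

    -- The two properties are carried together: monotonicity of the next row uses the bound in the
    -- current one, while the next bound follows from current monotonicity.
    increasing-and-bound : ∀ m → IncreasingToMiddle (3 ℕ.+ m) × CentralBound (3 ℕ.+ m)
    increasing-and-bound zero    = increasing₃ , centralBound₃
    increasing-and-bound (suc m) =
      let increasing , bound = increasing-and-bound m in
      increasing-suc increasing bound , centralBound-suc increasing (ℕ.m≤m+n 3 m)

    -- Unimodality of the integer rows, with peak at ⌊d/2⌋.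

    0≤a-half : ∀ d → 3 ℕ.≤ d → ∀ k → k ℕ.≤ ⌊ suc d /2⌋ → 0ℤ ≤ a d (+ k)
    0≤a-half d 3≤d k k≤half with ℕ.m≤n⇒∃[o]m+o≡n 3≤d
    ... | m , refl with ℕ.m≤n⇒∃[o]m+o≡n (ℕ.≤-trans (ℕ.+-mono-≤ k≤half k≤half) half+half≤1+d)
      where
      half+half≤1+d : ⌊ suc d /2⌋ ℕ.+ ⌊ suc d /2⌋ ℕ.≤ suc d
      half+half≤1+d = ℕ.≤-trans (ℕ.+-monoʳ-≤ ⌊ suc d /2⌋ (ℕ.⌊n/2⌋≤⌈n/2⌉ (suc d)))
        (ℕ.≤-reflexive (ℕ.⌊n/2⌋+⌈n/2⌉≡n (suc d)))
    ...   | r , k+k+r≡1+d = proj₁ (increasing-and-bound m) (+ k) r (cong +_ k+k+r≡1+d)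

    t-increasing : ∀ d → 3 ℕ.≤ d → ∀ k → k ℕ.< ⌊ d /2⌋ → t d (+ k) ≤ t d (+ suc k)
    t-increasing d 3≤d k k<half =
      0≤i-j⇒j≤i (0≤a-half d 3≤d (suc k) (ℕ.≤-trans k<half (ℕ.⌊n/2⌋-mono (ℕ.n≤1+n d))))

    t-decreasing : ∀ d → 3 ℕ.≤ d → ∀ k → ⌊ d /2⌋ ℕ.≤ k → k ℕ.< d → t d (+ suc k) ≤ t d (+ k)
    -- The difference at k + 1 is minus the one at j = d - k. From k ≥ ⌊d/2⌋ follows j ≤ ⌈d/2⌉ =
    -- ⌊(d+1)/2⌋, so j lies in the left half.
    t-decreasing d 3≤d k half≤k k<d with ℕ.m≤n⇒∃[o]m+o≡n (ℕ.<⇒≤ k<d)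
    ... | j , k+j≡d = i-j≤0⇒i≤j (subst (_≤ 0ℤ)
      (sym (a-antisymmetric d {+ suc k} {+ j} (cong +[1+_] k+j≡d)))
      (neg-mono-≤ (0≤a-half d 3≤d j (ℕ.+-cancelˡ-≤ k j _ (begin
        k ℕ.+ j                 ≡⟨ k+j≡d ⟩
        d                       ≡⟨ ℕ.⌊n/2⌋+⌈n/2⌉≡n d ⟨
        ⌊ d /2⌋ ℕ.+ ⌈ d /2⌉     ≤⟨ ℕ.+-monoˡ-≤ ⌈ d /2⌉ half≤k ⟩
        k ℕ.+ ⌊ suc d /2⌋       ∎)))))
      where open ℕ.≤-Reasoning

-- The embedding of the integers into the rationals.

open import Data.Rational as ℚ using (ℚ; 0ℚ; 1ℚ; _+_; _*_; -_; _-_; _≤_; _/_; toℚᵘ)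
open import Data.Rational.Properties
open import Tactic.RingSolver using (solve-∀)

ring : AlmostCommutativeRing 0ℓ 0ℓ
ring = fromCommutativeRing +-*-commutativeRing (λ x → dec⇒maybe (0ℚ ≟ x))

fromℤ : ℤ → ℚ
fromℤ i = i / 1

-- `i / 1` is computed through a gcd, whereas the unnormalised fraction has denominator one on the
-- nose (stored as its predecessor 0). The laws below are proved on that side.
fromℤ≃ : ∀ i → toℚᵘ (fromℤ i) ℚᵘ.≃ ℚᵘ.mkℚᵘ i 0
fromℤ≃ i = toℚᵘ-fromℚᵘ (ℚᵘ.mkℚᵘ i 0)

fromℤ-+ : ∀ i j → fromℤ (i ℤ.+ j) ≡ fromℤ i + fromℤ j
fromℤ-+ i j = toℚᵘ-injective (ℚᵘ.≃-trans (fromℤ≃ (i ℤ.+ j)) (ℚᵘ.≃-sym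
  (ℚᵘ.≃-trans (toℚᵘ-homo-+ (fromℤ i) (fromℤ j))
  (ℚᵘ.≃-trans (ℚᵘ.+-cong (fromℤ≃ i) (fromℤ≃ j)) (ℚᵘ.*≡* (lemma i j))))))
  where
  lemma : ∀ i j → (i ℤ.* + 1 ℤ.+ j ℤ.* + 1) ℤ.* + 1 ≡ (i ℤ.+ j) ℤ.* + 1
  lemma = ℤ.solve-∀

fromℤ-* : ∀ i j → fromℤ (i ℤ.* j) ≡ fromℤ i * fromℤ j
fromℤ-* i j = toℚᵘ-injective (ℚᵘ.≃-trans (fromℤ≃ (i ℤ.* j)) (ℚᵘ.≃-sym
  (ℚᵘ.≃-trans (toℚᵘ-homo-* (fromℤ i) (fromℤ j))
  (ℚᵘ.*-cong (fromℤ≃ i) (fromℤ≃ j)))))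

fromℤ-neg : ∀ i → fromℤ (ℤ.- i) ≡ - fromℤ i
fromℤ-neg i = toℚᵘ-injective (ℚᵘ.≃-trans (fromℤ≃ (ℤ.- i)) (ℚᵘ.≃-sym
  (ℚᵘ.≃-trans (toℚᵘ-homo‿- (fromℤ i)) (ℚᵘ.-‿cong (fromℤ≃ i)))))

fromℤ-minus : ∀ i j → fromℤ (i ℤ.- j) ≡ fromℤ i - fromℤ j
fromℤ-minus i j = trans (fromℤ-+ i (ℤ.- j)) (cong (_+_ (fromℤ i)) (fromℤ-neg j))

fromℤ-mono-≤ : ∀ {i j} → i ℤ.≤ j → fromℤ i ≤ fromℤ j
fromℤ-mono-≤ {i} {j} i≤j = toℚᵘ-cancel-≤ (ℚᵘ.≤-respˡ-≃ (ℚᵘ.≃-sym (fromℤ≃ i))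
  (ℚᵘ.≤-respʳ-≃ (ℚᵘ.≃-sym (fromℤ≃ j)) (ℚᵘ.*≤* (ℤ.*-monoʳ-≤-nonNeg (+ 1) i≤j))))

fromℤ-mono-< : ∀ {i j} → i ℤ.< j → fromℤ i ℚ.< fromℤ j
fromℤ-mono-< {i} {j} i<j = toℚᵘ-cancel-< (ℚᵘ.<-respˡ-≃ (ℚᵘ.≃-sym (fromℤ≃ i))
  (ℚᵘ.<-respʳ-≃ (ℚᵘ.≃-sym (fromℤ≃ j)) (ℚᵘ.*<* (ℤ.*-monoʳ-<-pos (+ 1) i<j))))

fromℤ-*-/ : ∀ i δ .{{_ : ℕ.NonZero δ}} → fromℤ (+ δ) * (i / δ) ≡ fromℤ i
fromℤ-*-/ i δ@(suc s) = toℚᵘ-injective (ℚᵘ.≃-trans (toℚᵘ-homo-* (fromℤ (+ δ)) (i / δ))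
  (ℚᵘ.≃-trans (ℚᵘ.*-cong (fromℤ≃ (+ δ)) (toℚᵘ-fromℚᵘ (ℚᵘ.mkℚᵘ i s)))
  (ℚᵘ.≃-trans (ℚᵘ.*≡* (lemma (+ δ) i)) (ℚᵘ.≃-sym (fromℤ≃ i)))))
  where
  lemma : ∀ D i → D ℤ.* i ℤ.* + 1 ≡ i ℤ.* (+ 1 ℤ.* D)
  lemma = ℤ.solve-∀

-- Coefficients of sums, products and derivatives.

coeff-⊕ : ∀ f g k → coeff (f ⊕ g) k ≡ coeff f k + coeff g k
coeff-⊕ []      g       k       = sym (+-identityˡ _)
coeff-⊕ (a ∷ f) []      k       = sym (+-identityʳ _)
coeff-⊕ (a ∷ f) (b ∷ g) zero    = refl
coeff-⊕ (a ∷ f) (b ∷ g) (suc k) = coeff-⊕ f g k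

coeff-· : ∀ c f k → coeff (c · f) k ≡ c * coeff f k
coeff-· c []      k       = sym (*-zeroʳ c)
coeff-· c (a ∷ f) zero    = refl
coeff-· c (a ∷ f) (suc k) = coeff-· c f k

coeff-weightFrom : ∀ m f k → coeff (weightFrom m f) k ≡ fromℤ (+ (m ℕ.+ k)) * coeff f k
coeff-weightFrom m []      k       = sym (*-zeroʳ (fromℤ (+ (m ℕ.+ k))))
coeff-weightFrom m (a ∷ f) zero    = cong (λ i → fromℤ (+ i) * a) (sym (ℕ.+-identityʳ m))
coeff-weightFrom m (a ∷ f) (suc k) = trans (coeff-weightFrom (suc m) f k)
  (cong (λ i → fromℤ (+ i) * coeff f k) (sym (ℕ.+-suc m k)))

-- Integer exponents make coefficient formulas uniform at the lower end.
coeffℤ : Poly → ℤ → ℚ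
coeffℤ f (+ k)    = coeff f k
coeffℤ f -[1+ _ ] = 0ℚ

coeffℤ-⊕ : ∀ f g k → coeffℤ (f ⊕ g) k ≡ coeffℤ f k + coeffℤ g k
coeffℤ-⊕ f g (+ k)    = coeff-⊕ f g k
coeffℤ-⊕ f g -[1+ _ ] = refl

coeffℤ-∷⊗ : ∀ a f g k → coeffℤ ((a ∷ f) ⊗ g) k ≡ a * coeffℤ g k + coeffℤ (f ⊗ g) (k ℤ.- 1ℤ)
coeffℤ-∷⊗ a f g +0       = trans (coeff-⊕ (a · g) _ 0) (cong (_+ 0ℚ) (coeff-· a g 0))
coeffℤ-∷⊗ a f g +[1+ k ] = trans (coeff-⊕ (a · g) _ (suc k))
  (cong (_+ coeff (f ⊗ g) k) (coeff-· a g (suc k)))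
coeffℤ-∷⊗ a f g -[1+ k ] = sym (cong (_+ 0ℚ) (*-zeroʳ a))

coeffℤ-derivative : ∀ f k → coeffℤ (derivative f) k ≡ fromℤ (k ℤ.+ 1ℤ) * coeffℤ f (k ℤ.+ 1ℤ)
coeffℤ-derivative []      (+ k)          = sym (*-zeroʳ (fromℤ (+ k ℤ.+ 1ℤ)))
coeffℤ-derivative (a ∷ f) (+ k)
  rewrite ℕ.+-comm k 1 = coeff-weightFrom 1 f k
-- At k = -1 the constant term of f appears, and it is killed by the factor k + 1 = 0.
coeffℤ-derivative f       -[1+ 0 ]       = sym (*-zeroˡ (coeff f 0))
coeffℤ-derivative f       -[1+ suc k ]   = sym (*-zeroʳ (fromℤ -[1+ k ]))

fromℤ-combination : ∀ p x q y r z u w →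
  fromℤ (p ℤ.* x ℤ.+ q ℤ.* y ℤ.+ r ℤ.* z ℤ.+ u ℤ.* w)
  ≡ fromℤ p * fromℤ x + fromℤ q * fromℤ y + fromℤ r * fromℤ z + fromℤ u * fromℤ w
fromℤ-combination p x q y r z u w =
  trans (fromℤ-+ (p ℤ.* x ℤ.+ q ℤ.* y ℤ.+ r ℤ.* z) (u ℤ.* w)) (cong₂ _+_
    (trans (fromℤ-+ (p ℤ.* x ℤ.+ q ℤ.* y) (r ℤ.* z)) (cong₂ _+_
      (trans (fromℤ-+ (p ℤ.* x) (q ℤ.* y)) (cong₂ _+_ (fromℤ-* p x) (fromℤ-* q y)))
      (fromℤ-* r z)))
    (fromℤ-* u w))

coeffℤ-cong : ∀ {f g} → f ≈ g → ∀ k → coeffℤ f k ≡ coeffℤ g k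
coeffℤ-cong f≈g (+ k)    = f≈g k
coeffℤ-cong f≈g -[1+ _ ] = refl

coeffℤ-∷∷∷⊗ : ∀ a b c f g k → coeffℤ ((a ∷ b ∷ c ∷ f) ⊗ g) k ≡
  a * coeffℤ g k + (b * coeffℤ g (k ℤ.- 1ℤ) + (c * coeffℤ g (k ℤ.- 1ℤ ℤ.- 1ℤ)
  + coeffℤ (f ⊗ g) (k ℤ.- 1ℤ ℤ.- 1ℤ ℤ.- 1ℤ)))
coeffℤ-∷∷∷⊗ a b c f g k = trans (coeffℤ-∷⊗ a (b ∷ c ∷ f) g k) (cong (λ x → a * coeffℤ g k + x)
  (trans (coeffℤ-∷⊗ b (c ∷ f) g (k ℤ.- 1ℤ)) (cong (λ x → b * coeffℤ g (k ℤ.- 1ℤ) + x)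
    (coeffℤ-∷⊗ c f g (k ℤ.- 1ℤ ℤ.- 1ℤ)))))

coeffℤ-[] : ∀ k → coeffℤ [] k ≡ 0ℚ
coeffℤ-[] (+ _)    = refl
coeffℤ-[] -[1+ _ ] = refl

-- The right-hand side of the recurrence, for c = (n-δ+1)/δ and e = 1/δ.
next : ℚ → ℚ → Poly → Poly
next c e f = ((1ℚ + c) ∷ 1ℚ ∷ c ∷ []) ⊗ f ⊕ (e · (1ℚ ∷ (- 1ℚ) ∷ 1ℚ ∷ (- 1ℚ) ∷ [])) ⊗ derivative f

-- The units and trailing zeros left by peeling the coefficient lists are kept; `distribute` clears
-- them with one call of the ring solver.
coeffℤ-next : ∀ c e f k →
  let x = coeffℤ f k
      y = coeffℤ f (k ℤ.- 1ℤ)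
      z = coeffℤ f (k ℤ.- 1ℤ ℤ.- 1ℤ)
      w = coeffℤ f (k ℤ.+ 1ℤ)
  in coeffℤ (next c e f) k ≡
    ((1ℚ + c) * x + (1ℚ * y + (c * z + 0ℚ)))
    + (e * 1ℚ * (fromℤ (k ℤ.+ 1ℤ) * w) + (e * (- 1ℚ) * (fromℤ k * x)
    + (e * 1ℚ * (fromℤ (k ℤ.- 1ℤ) * y) + (e * (- 1ℚ) * (fromℤ (k ℤ.- 1ℤ ℤ.- 1ℤ) * z) + 0ℚ))))
coeffℤ-next c e f k = trans
  (coeffℤ-⊕ (((1ℚ + c) ∷ 1ℚ ∷ c ∷ []) ⊗ f) _ k)
  (cong₂ _+_
    (trans (coeffℤ-∷∷∷⊗ (1ℚ + c) 1ℚ c [] f k)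
      (cong (λ u → (1ℚ + c) * coeffℤ f k + (1ℚ * coeffℤ f (k ℤ.- 1ℤ) + (c * coeffℤ f (k ℤ.- 1ℤ ℤ.- 1ℤ) + u)))
        (coeffℤ-[] (k ℤ.- 1ℤ ℤ.- 1ℤ ℤ.- 1ℤ))))
    (trans (coeffℤ-∷∷∷⊗ (e * 1ℚ) (e * (- 1ℚ)) (e * 1ℚ) (e * (- 1ℚ) ∷ []) f′ k)
      (cong₂ _+_ (cong (e * 1ℚ *_) (coeffℤ-derivative f k))
      (cong₂ _+_ (cong (e * (- 1ℚ) *_) (coeffℤ-derivative-pred k))
      (cong₂ _+_ (cong (e * 1ℚ *_) (coeffℤ-derivative-pred (k ℤ.- 1ℤ)))
      (trans (coeffℤ-∷⊗ (e * (- 1ℚ)) [] f′ (k ℤ.- 1ℤ ℤ.- 1ℤ ℤ.- 1ℤ))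
      (cong₂ _+_ (cong (e * (- 1ℚ) *_) (coeffℤ-derivative-pred (k ℤ.- 1ℤ ℤ.- 1ℤ)))
                 (coeffℤ-[] (k ℤ.- 1ℤ ℤ.- 1ℤ ℤ.- 1ℤ ℤ.- 1ℤ)))))))))
  where
  f′ = derivative f
  coeffℤ-derivative-pred : ∀ i → coeffℤ f′ (i ℤ.- 1ℤ) ≡ fromℤ i * coeffℤ f i
  coeffℤ-derivative-pred i = trans (coeffℤ-derivative f (i ℤ.- 1ℤ))
    (cong (λ j → fromℤ j * coeffℤ f j) (IntegerRecurrence.k-1+1≡k i))

-- Transfer from the integer triangle to the polynomials `T`, with s = δ - 1 and n = d + s.

module Scaling (s : ℕ) (T : ℕ → Poly) (T-base : T s ≈ (1ℚ ∷ []))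
  (T-next : ∀ n → s ℕ.≤ n →
    T (suc n) ≈ next ((+ n ℤ.- + suc s ℤ.+ + 1) / suc s) (+ 1 / suc s) (T n))
  where

  open IntegerRecurrence.Coefficients s

  scale : ℕ → ℚ
  scale zero    = 1ℚ
  scale (suc d) = fromℤ (+ suc s) * scale d

  0<scale : ∀ d → 0ℚ ℚ.< scale d
  0<scale zero    = positive⁻¹ 1ℚ
  0<scale (suc d) = positive⁻¹ _
    {{pos*pos⇒pos (fromℤ (+ suc s)) {{ℚ.positive (fromℤ-mono-< {0ℤ} {+ suc s} (ℤ.+<+ (s≤s z≤n)))}}
                  (scale d) {{ℚ.positive (0<scale d)}}}}

  -- The new factor δ in `scale (suc d)` clears the denominators of one step, since δc = d and δe =
  -- 1; the other factor δ^d is absorbed by the induction hypothesis.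
  scale-coeffℤ : ∀ d k → scale d * coeffℤ (T (d ℕ.+ s)) k ≡ fromℤ (t d k)
  scale-coeffℤ zero +0       = trans (*-identityˡ _) (T-base 0)
  scale-coeffℤ zero +[1+ k ] = trans (*-identityˡ _) (T-base (suc k))
  scale-coeffℤ zero -[1+ k ] = refl
  scale-coeffℤ (suc d) k = begin
    Δ * P * coeffℤ (T (suc n)) k
      ≡⟨ cong (Δ * P *_) (trans (coeffℤ-cong (T-next n (ℕ.m≤n+m s d)) k) (coeffℤ-next c e (T n) k)) ⟩
    Δ * P * (((1ℚ + c) * x + (1ℚ * y + (c * z + 0ℚ)))
       + (e * 1ℚ * (fromℤ (k ℤ.+ 1ℤ) * w) + (e * (- 1ℚ) * (fromℤ k * x)
       + (e * 1ℚ * (fromℤ (k ℤ.- 1ℤ) * y) + (e * (- 1ℚ) * (fromℤ (k ℤ.- 1ℤ ℤ.- 1ℤ) * z) + 0ℚ)))))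
      ≡⟨ distribute Δ P c e x y z w (fromℤ (k ℤ.+ 1ℤ)) (fromℤ k) (fromℤ (k ℤ.- 1ℤ)) (fromℤ (k ℤ.- 1ℤ ℤ.- 1ℤ)) ⟩
    weighted (Δ * c) (Δ * e) (P * x) (P * y) (P * z) (P * w)
      ≡⟨ cong₂ (λ C E → weighted C E (P * x) (P * y) (P * z) (P * w)) Δ*c≡d (fromℤ-*-/ (+ 1) (suc s)) ⟩
    weighted (fromℤ (+ d)) 1ℚ (P * x) (P * y) (P * z) (P * w)
      ≡⟨ cong₂ (λ X Y → weighted (fromℤ (+ d)) 1ℚ X Y (P * z) (P * w))
           (scale-coeffℤ d k) (scale-coeffℤ d (k ℤ.- 1ℤ)) ⟩
    weighted (fromℤ (+ d)) 1ℚ (fromℤ X) (fromℤ Y) (P * z) (P * w)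
      ≡⟨ cong₂ (λ Z W → weighted (fromℤ (+ d)) 1ℚ (fromℤ X) (fromℤ Y) Z W)
           (scale-coeffℤ d (k ℤ.- 1ℤ ℤ.- 1ℤ)) (scale-coeffℤ d (k ℤ.+ 1ℤ)) ⟩
    weighted (fromℤ (+ d)) 1ℚ (fromℤ X) (fromℤ Y) (fromℤ Z) (fromℤ W)
      ≡⟨ cong₂ _+_ (cong₂ _+_ (cong₂ _+_
           (cong (_* fromℤ X) weight₁) (cong (_* fromℤ Y) weight₂))
           (cong (_* fromℤ Z) weight₃)) (cong (_* fromℤ W) (*-identityˡ (fromℤ (k ℤ.+ 1ℤ)))) ⟩
    fromℤ (+ suc s ℤ.+ + d ℤ.- k) * fromℤ X + fromℤ (+ s ℤ.+ k) * fromℤ Y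
    + fromℤ (+ d ℤ.- k ℤ.+ + 2) * fromℤ Z + fromℤ (k ℤ.+ 1ℤ) * fromℤ W
      ≡⟨ fromℤ-combination (+ suc s ℤ.+ + d ℤ.- k) X (+ s ℤ.+ k) Y (+ d ℤ.- k ℤ.+ + 2) Z (k ℤ.+ 1ℤ) W ⟨
    fromℤ (t (suc d) k) ∎
    where
    open ≡-Reasoning
    n = d ℕ.+ s
    c = (+ n ℤ.- + suc s ℤ.+ + 1) / suc s
    e = + 1 / suc s
    Δ = fromℤ (+ suc s)
    P = scale d
    x = coeffℤ (T n) k
    y = coeffℤ (T n) (k ℤ.- 1ℤ)
    z = coeffℤ (T n) (k ℤ.- 1ℤ ℤ.- 1ℤ)
    w = coeffℤ (T n) (k ℤ.+ 1ℤ)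
    X = t d k
    Y = t d (k ℤ.- 1ℤ)
    Z = t d (k ℤ.- 1ℤ ℤ.- 1ℤ)
    W = t d (k ℤ.+ 1ℤ)
    weighted : (C E X Y Z W : ℚ) → ℚ
    weighted C E X Y Z W =
      (Δ + C - E * fromℤ k) * X + (Δ + E * fromℤ (k ℤ.- 1ℤ)) * Y
      + (C - E * fromℤ (k ℤ.- 1ℤ ℤ.- 1ℤ)) * Z + E * fromℤ (k ℤ.+ 1ℤ) * W
    distribute : ∀ Δ P c e x y z w k₀ k₁ k₂ k₃ →
      Δ * P * (((1ℚ + c) * x + (1ℚ * y + (c * z + 0ℚ)))
       + (e * 1ℚ * (k₀ * w) + (e * (- 1ℚ) * (k₁ * x) + (e * 1ℚ * (k₂ * y) + (e * (- 1ℚ) * (k₃ * z) + 0ℚ)))))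
      ≡ (Δ + Δ * c - Δ * e * k₁) * (P * x) + (Δ + Δ * e * k₂) * (P * y)
        + (Δ * c - Δ * e * k₃) * (P * z) + Δ * e * k₀ * (P * w)
    distribute = solve-∀ ring
    Δ*c≡d : Δ * c ≡ fromℤ (+ d)
    Δ*c≡d = trans (fromℤ-*-/ (+ n ℤ.- + suc s ℤ.+ + 1) (suc s)) (cong fromℤ (lemma (+ d) (+ s)))
      where
      lemma : ∀ d s → d ℤ.+ s ℤ.- (+ 1 ℤ.+ s) ℤ.+ + 1 ≡ d
      lemma = ℤ.solve-∀
    weight₁ : Δ + fromℤ (+ d) - 1ℚ * fromℤ k ≡ fromℤ (+ suc s ℤ.+ + d ℤ.- k)
    weight₁ = sym (trans (fromℤ-minus (+ suc s ℤ.+ + d) k)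
      (cong₂ _-_ (fromℤ-+ (+ suc s) (+ d)) (sym (*-identityˡ (fromℤ k)))))
    weight₂ : Δ + 1ℚ * fromℤ (k ℤ.- 1ℤ) ≡ fromℤ (+ s ℤ.+ k)
    weight₂ = trans (cong (λ x → Δ + x) (*-identityˡ _))
      (trans (sym (fromℤ-+ (+ suc s) (k ℤ.- 1ℤ))) (cong fromℤ (lemma (+ s) k)))
      where
      lemma : ∀ s k → + 1 ℤ.+ s ℤ.+ (k ℤ.- 1ℤ) ≡ s ℤ.+ k
      lemma = ℤ.solve-∀
    weight₃ : fromℤ (+ d) - 1ℚ * fromℤ (k ℤ.- 1ℤ ℤ.- 1ℤ) ≡ fromℤ (+ d ℤ.- k ℤ.+ + 2)
    weight₃ = trans (cong (λ x → fromℤ (+ d) - x) (*-identityˡ _))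
      (trans (sym (fromℤ-minus (+ d) (k ℤ.- 1ℤ ℤ.- 1ℤ))) (cong fromℤ (lemma (+ d) k)))
      where
      lemma : ∀ d k → d ℤ.- (k ℤ.- 1ℤ ℤ.- 1ℤ) ≡ d ℤ.- k ℤ.+ + 2
      lemma = ℤ.solve-∀

  coeff-mono : ∀ d {i j} → t d (+ i) ℤ.≤ t d (+ j) → coeff (T (d ℕ.+ s)) i ≤ coeff (T (d ℕ.+ s)) j
  coeff-mono d {i} {j} tᵢ≤tⱼ = *-cancelˡ-≤-pos (scale d) {{ℚ.positive (0<scale d)}}
    (subst₂ _≤_ (sym (scale-coeffℤ d (+ i))) (sym (scale-coeffℤ d (+ j))) (fromℤ-mono-≤ tᵢ≤tⱼ))

  vanishesAbove : ∀ d → VanishesAbove (T (d ℕ.+ s)) d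
  vanishesAbove d k d<k with ℕ.m≤n⇒∃[o]m+o≡n d<k
  ... | j , refl = *-cancelˡ-nonZero (trans (scale-coeffℤ d (+ suc (d ℕ.+ j)))
    (cong fromℤ (trans (cong (λ i → t d (+ i)) (sym (ℕ.+-suc d j))) (t-above d j))))
    where
    -- The positive factor is cancelled from the inequality in each direction.
    *-cancelˡ-nonZero : ∀ {q} → scale d * q ≡ 0ℚ → q ≡ 0ℚ
    *-cancelˡ-nonZero {q} p*q≡0 = ≤-antisym
      (*-cancelˡ-≤-pos (scale d) {{ℚ.positive (0<scale d)}} (≤-reflexive (trans p*q≡0 (sym (*-zeroʳ (scale d))))))
      (*-cancelˡ-≤-pos (scale d) {{ℚ.positive (0<scale d)}} (≤-reflexive (trans (*-zeroʳ (scale d)) (sym p*q≡0))))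

  hasDegree : ∀ d → HasDegree (T (d ℕ.+ s)) d
  hasDegree d = (λ top≡0 → <⇒≢ (fromℤ-mono-< (0<t-top d))
      (trans (sym (*-zeroʳ (scale d))) (trans (cong (scale d *_) (sym top≡0)) (scale-coeffℤ d (+ d)))))
    , vanishesAbove d

  unimodal : ∀ d → 3 ℕ.≤ d → Unimodal (T (d ℕ.+ s))
  unimodal d 3≤d = d , vanishesAbove d , ⌊ d /2⌋ , ℕ.⌊n/2⌋≤n d
    , (λ k k<half → coeff-mono d (t-increasing d 3≤d k k<half))
    , (λ k half≤k k<d → coeff-mono d (t-decreasing d 3≤d k half≤k k<d))

theorem4p9 : (δ : ℕ) .{{_ : NonZero δ}} (T : ℕ → Poly) →
    T (δ ℕ.∸ 1) ≈ (1ℚ ∷ []) →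
    (∀ n → δ ℕ.∸ 1 ℕ.≤ n →
    let c = (+ n ℤ.- + δ ℤ.+ + 1) / δ in
    T (suc n) ≈
    ((1ℚ + c) ∷ 1ℚ ∷ c ∷ []) ⊗ T n
    ⊕ ((+ 1 / δ) · (1ℚ ∷ (- 1ℚ) ∷ 1ℚ ∷ (- 1ℚ) ∷ [])) ⊗ derivative (T n)) →
    (∀ n → δ ℕ.∸ 1 ℕ.≤ n → HasDegree (T n) ((n ℕ.+ 1) ℕ.∸ δ))
    × (∀ n → δ ℕ.+ 2 ℕ.≤ n → Unimodal (T n))
-- With d = n - s, the bound n ≥ δ + 2 = s + 3 becomes d ≥ 3, the start of the induction.
theorem4p9 (suc s) T T-base T-next = degree , λ n s+3≤n →
    subst (λ i → Unimodal (T i)) (ℕ.m∸n+n≡m (ℕ.≤-trans s≤s+3 s+3≤n))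
      (unimodal (n ℕ.∸ s) (ℕ.m+n≤o⇒m≤o∸n 3 (ℕ.≤-trans (ℕ.≤-reflexive 3+s≡s+3) s+3≤n)))
  where
  open Scaling s T T-base T-next
  s≤s+3 : s ℕ.≤ suc s ℕ.+ 2
  s≤s+3 = ℕ.≤-trans (ℕ.n≤1+n s) (ℕ.m≤m+n (suc s) 2)
  3+s≡s+3 : 3 ℕ.+ s ≡ suc s ℕ.+ 2
  3+s≡s+3 = cong suc (ℕ.+-comm 2 s)
  degree : ∀ n → s ℕ.≤ n → HasDegree (T n) ((n ℕ.+ 1) ℕ.∸ suc s)
  degree n s≤n = subst₂ (λ i d → HasDegree (T i) d) (ℕ.m∸n+n≡m s≤n)
    (cong (ℕ._∸ suc s) (ℕ.+-comm 1 n)) (hasDegree (n ℕ.∸ s))
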